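{- Let $\mathbf{RCi}$ be the logic obtained from $\mathbf{RmbC}$ by adding the axiom schemas (cf): $\neg\neg\alpha\to\alpha$ and (ci): $\neg\circ\alpha\to(\alpha\wedge\neg\alpha)$. Then $\mathbf{RCi}$ is an extension of the logic $\mathbf{Ci}$ (that is, $\Gamma\vdash_{\mathbf{Ci}}\varphi$ implies $\Gamma\vdash_{\mathbf{RCi}}\varphi$) which satisfies the replacement property, derives every instance of the schema (cl): $\neg(\alpha\wedge\neg\alpha)\to\circ\alpha$, and is paraconsistent (that is, $\varphi,\neg\varphi\nvdash_{\mathbf{RCi}}\psi$ for some formulas $\varphi,\psi$).
   Context: Let $\Sigma=\{\wedge,\vee,\to,\neg,\circ\}$ ($\neg,\circ$ unary, the others binary) and let $For(\Sigma)$ be the set of formulas over $\Sigma$ generated by a denumerable set $\mathcal V$ of propositional variables. $\alpha\leftrightarrow\beta$ abbreviates $(\alpha\to\beta)\wedge(\beta\to\alpha)$. The logic $\mathbf{mbC}$ is given by the Hilbert calculus with axiom schemas: (Ax1) $\alpha\to(\beta\to\alpha)$; (Ax2) $(\alpha\to(\beta\to\gamma))\to((\alpha\to\beta)\to(\alpha\to\gamma))$; (Ax3) $\alpha\to(\beta\to(\alpha\wedge\beta))$; (Ax4) $(\alpha\wedge\beta)\to\alpha$; (Ax5) $(\alpha\wedge\beta)\to\beta$; (Ax6) $\alpha\to(\alpha\vee\beta)$; (Ax7) $\beta\to(\alpha\vee\beta)$; (Ax8) $(\alpha\to\gamma)\to((\beta\to\gamma)\to((\alpha\vee\beta)\to\gamma))$;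 (Ax9) $(\alpha\to\beta)\vee\alpha$; (Ax10) $\alpha\vee\neg\alpha$; (bc1) $\circ\alpha\to(\alpha\to(\neg\alpha\to\beta))$; and the single rule modus ponens (MP): from $\alpha$ and $\alpha\to\beta$ infer $\beta$. The logic $\mathbf{Ci}$ is $\mathbf{mbC}$ plus the axiom schemas (cf) and (ci); derivations from premises in $\mathbf{mbC}$ and $\mathbf{Ci}$ are the usual Hilbert-style ones. The calculus $\mathbf{RmbC}$ is obtained from $\mathbf{mbC}$ by adding the rules $(\mathbf R_\neg)$: from $\alpha\leftrightarrow\beta$ infer $\neg\alpha\leftrightarrow\neg\beta$; and $(\mathbf R_\circ)$: from $\alpha\leftrightarrow\beta$ infer $\circ\alpha\leftrightarrow\circ\beta$. In $\mathbf{RmbC}$ and its axiomatic extensions, $\varphi$ is a theorem ($\vdash\varphi$) if there is a finite sequence of formulas ending in $\varphi$ each of which is an instance of an axiom schema or follows from earlier formulas of the sequence by a rule; and $\Gamma\vdash\varphi$ means that either $\vdash\varphi$ or there is a finite non-empty $\{\gamma_1,\dots,\gamma_n\}\subseteq\Gamma$ with $\vdash(\gamma_1\wedge(\gamma_2\wedge(\cdots\wedge(\gamma_{n-1}\wedge\gamma_n)\cdots)))\to\varphi$. Replacement property: if $\alpha\leftrightarrow\beta$ is a theorem, then $\gamma[p/\alpha]\leftrightarrow\gamma[p/\beta]$ is a theorem for every formula $\gamma$ and variable $p$, where $\gamma[p/\alpha]$ is the result of replacing every occurrence of $p$ in $\gamma$ by $\alpha$. -}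

module Defs where

open import Data.Bool using (if_then_else_)
open import Data.List using (List; []; _∷_)
open import Data.List.Membership.Propositional using (_∈_)
open import Data.List.NonEmpty using (List⁺; foldr₁; toList)
open import Data.List.Relation.Unary.All using (All)
open import Data.Nat using (ℕ; _≡ᵇ_)
open import Data.Product using (∃-syntax; _×_)
open import Data.Sum using (_⊎_)
open import Level using (0ℓ)
open import Relation.Unary using (Pred; _∪_)

infix  25 ∼_ ○_
infixr 23 _∧_
infixr 22 _∨_
infixr 21 _⇒_
infix  20 _⇔_

-- ∼ and ○ are the unary connectives ¬ and ∘ of Σ; the names avoid a clash with
-- the metatheoretic negation and with function composition.
data Formula : Set where
  var         : ℕ → Formula
  _∧_ _∨_ _⇒_ : Formula → Formula → Formula
  ∼_ ○_       : Formula → Formula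

_⇔_ : Formula → Formula → Formula
α ⇔ β = (α ⇒ β) ∧ (β ⇒ α)

infix 30 _[_/_]

_[_/_] : Formula → ℕ → Formula → Formula
var q   [ p / α ] = if p ≡ᵇ q then α else var q
(γ ∧ δ) [ p / α ] = γ [ p / α ] ∧ δ [ p / α ]
(γ ∨ δ) [ p / α ] = γ [ p / α ] ∨ δ [ p / α ]
(γ ⇒ δ) [ p / α ] = γ [ p / α ] ⇒ δ [ p / α ]
(∼ γ)   [ p / α ] = ∼ (γ [ p / α ])
(○ γ)   [ p / α ] = ○ (γ [ p / α ])

data mbCAxiom : Pred Formula 0ℓ where
  ax1  : ∀ α β   → mbCAxiom (α ⇒ (β ⇒ α))
  ax2  : ∀ α β γ → mbCAxiom ((α ⇒ (β ⇒ γ)) ⇒ ((α ⇒ β) ⇒ (α ⇒ γ)))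
  ax3  : ∀ α β   → mbCAxiom (α ⇒ (β ⇒ (α ∧ β)))
  ax4  : ∀ α β   → mbCAxiom ((α ∧ β) ⇒ α)
  ax5  : ∀ α β   → mbCAxiom ((α ∧ β) ⇒ β)
  ax6  : ∀ α β   → mbCAxiom (α ⇒ (α ∨ β))
  ax7  : ∀ α β   → mbCAxiom (β ⇒ (α ∨ β))
  ax8  : ∀ α β γ → mbCAxiom ((α ⇒ γ) ⇒ ((β ⇒ γ) ⇒ ((α ∨ β) ⇒ γ)))
  ax9  : ∀ α β   → mbCAxiom ((α ⇒ β) ∨ α)
  ax10 : ∀ α     → mbCAxiom (α ∨ ∼ α)
  bc1  : ∀ α β   → mbCAxiom (○ α ⇒ (α ⇒ (∼ α ⇒ β)))

data CfCiAxiom : Pred Formula 0ℓ where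
  cf : ∀ α → CfCiAxiom (∼ ∼ α ⇒ α)
  ci : ∀ α → CfCiAxiom (∼ ○ α ⇒ (α ∧ ∼ α))

-- Finite sequences of formulas are lists written in reverse: the head is the
-- last formula, and the tail consists of the formulas preceding it.
-- Step φs φ says that φ may be written after the formulas φs.
data IsDerivation (Step : List Formula → Pred Formula 0ℓ) : Pred (List Formula) 0ℓ where
  []  : IsDerivation Step []
  _∷_ : ∀ {φ φs} → Step φs φ → IsDerivation Step φs → IsDerivation Step (φ ∷ φs)

data HilbertStep (Axiom Γ : Pred Formula 0ℓ) (earlier : List Formula) : Pred Formula 0ℓ where
  axiom   : ∀ {φ} → Axiom φ → HilbertStep Axiom Γ earlier φ
  premise : ∀ {φ} → Γ φ → HilbertStep Axiom Γ earlier φ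
  mp      : ∀ {α β} → α ∈ earlier → (α ⇒ β) ∈ earlier → HilbertStep Axiom Γ earlier β

data RStep (Axiom : Pred Formula 0ℓ) (earlier : List Formula) : Pred Formula 0ℓ where
  axiom : ∀ {φ} → Axiom φ → RStep Axiom earlier φ
  mp    : ∀ {α β} → α ∈ earlier → (α ⇒ β) ∈ earlier → RStep Axiom earlier β
  R∼    : ∀ {α β} → (α ⇔ β) ∈ earlier → RStep Axiom earlier (∼ α ⇔ ∼ β)
  R○    : ∀ {α β} → (α ⇔ β) ∈ earlier → RStep Axiom earlier (○ α ⇔ ○ β)

infix 4 _⊢Ci_ ⊢RmbC+[_]_ _⊢RmbC+[_]_ ⊢RCi_ _⊢RCi_

_⊢Ci_ : Pred Formula 0ℓ → Pred Formula 0ℓ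
Γ ⊢Ci φ = ∃[ φs ] IsDerivation (HilbertStep (mbCAxiom ∪ CfCiAxiom) Γ) (φ ∷ φs)

-- RmbC extended by the axioms in Extra; RmbC itself is the case Extra = ∅.
⊢RmbC+[_]_ : Pred Formula 0ℓ → Pred Formula 0ℓ
⊢RmbC+[ Extra ] φ = ∃[ φs ] IsDerivation (RStep (mbCAxiom ∪ Extra)) (φ ∷ φs)

-- foldr₁ nests to the right: γ₁ ∧ (γ₂ ∧ (⋯ ∧ γₙ)).
⋀ : List⁺ Formula → Formula
⋀ = foldr₁ _∧_

-- Premises are not used inside derivations, so that R∼ and R○ apply to
-- theorems only.
_⊢RmbC+[_]_ : Pred Formula 0ℓ → Pred Formula 0ℓ → Pred Formula 0ℓ
Γ ⊢RmbC+[ Extra ] φ =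
  (⊢RmbC+[ Extra ] φ) ⊎
  (∃[ γs ] All Γ (toList γs) × (⊢RmbC+[ Extra ] ⋀ γs ⇒ φ))

⊢RCi_ : Pred Formula 0ℓ
⊢RCi φ = ⊢RmbC+[ CfCiAxiom ] φ

_⊢RCi_ : Pred Formula 0ℓ → Pred Formula 0ℓ
Γ ⊢RCi φ = Γ ⊢RmbC+[ CfCiAxiom ] φ

{-# OPTIONS --safe #-}

-- RCi is sound for the following 16-element Boolean algebra with operators:
-- the subsets of Bool × Bool, where neg is complementation except that
-- neg x = ¬x ∪ {(true , true)} and neg ¬x = x ∪ {(false , true)} for
-- x = {w | proj₁ w = true}, and circ a is the complement of a ∩ neg a.
-- Values of neg and circ are never x or ¬x, so neg is complementation on them;
-- this gives (cf) and (ci).  Paraconsistency holds because x ∩ neg x is nonempty.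
-- For (cl), ∼ ○ α and α ∧ ∼ α are equivalent already by (bc1) and (ci), so R∼
-- and (cf) yield ∼ (α ∧ ∼ α) ⇒ ∼ ∼ ○ α ⇒ ○ α.
module Submission where

open import Defs
open import Data.Bool as Bool using (Bool; true; false; not; _xor_)
open import Data.Bool.Properties
  using (∧-conicalˡ; ∧-conicalʳ; ∧-zeroʳ; ∨-identityʳ; ∨-zeroʳ; not-involutive)
open import Data.List using (List; []; _∷_; _++_)
open import Data.List.NonEmpty using (_∷_; _⁺++⁺_; toList)
open import Data.List.Relation.Binary.Subset.Propositional using (_⊆_)
open import Data.List.Relation.Binary.Subset.Propositional.Properties
  using (xs⊆xs++ys; xs⊆ys++xs)
open import Data.List.Relation.Unary.All as All using (All; []; _∷_)
open import Data.List.Relation.Unary.All.Properties using (++⁺)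
open import Data.List.Relation.Unary.Any using (here)
open import Data.Nat using (ℕ; zero; suc; _≡ᵇ_)
open import Data.Product using (_×_; ∃-syntax; _,_; proj₁)
open import Data.Sum using (inj₁; inj₂)
open import Level using (0ℓ)
open import Relation.Binary.PropositionalEquality
  using (_≡_; _≗_; refl; sym; trans; cong; cong₂)
open import Relation.Nullary using (¬_; contradiction)
open import Relation.Unary using (Pred; _∪_; ｛_｝)

-- Derivations

-- The predicate is carried for all earlier formulas at once, since a rule may refer back to any of
-- them.
IsDerivation-induction :
  ∀ {Step : List Formula → Pred Formula 0ℓ} {P : Pred Formula 0ℓ} →
  (∀ {φ φs} → Step φs φ → All P φs → P φ) →
  ∀ {φs} → IsDerivation Step φs → All P φs
IsDerivation-induction step []      = []
IsDerivation-induction step (s ∷ d) = step s ps ∷ ps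
  where ps = IsDerivation-induction step d

RStep-mono : ∀ {Axiom φs ψs φ} → φs ⊆ ψs → RStep Axiom φs φ → RStep Axiom ψs φ
RStep-mono φs⊆ψs (axiom a) = axiom a
RStep-mono φs⊆ψs (mp x f)  = mp (φs⊆ψs x) (φs⊆ψs f)
RStep-mono φs⊆ψs (R∼ e)    = R∼ (φs⊆ψs e)
RStep-mono φs⊆ψs (R○ e)    = R○ (φs⊆ψs e)

-- Lists are reversed, so `ψs` is written first; the steps of `φs` only gain earlier formulas.
IsDerivation-++ : ∀ {Axiom φs ψs} →
  IsDerivation (RStep Axiom) φs → IsDerivation (RStep Axiom) ψs →
  IsDerivation (RStep Axiom) (φs ++ ψs)
IsDerivation-++ []      e = e
IsDerivation-++ (s ∷ d) e = RStep-mono (xs⊆xs++ys _ _) s ∷ IsDerivation-++ d e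

module _ {Extra : Pred Formula 0ℓ} where

  infix 4 ⊢_
  private
    ⊢_ : Pred Formula 0ℓ
    ⊢ φ = ⊢RmbC+[ Extra ] φ

  ⊢-axiom : ∀ {φ} → (mbCAxiom ∪ Extra) φ → ⊢ φ
  ⊢-axiom a = [] , axiom a ∷ []

  ⊢-mbC : ∀ {φ} → mbCAxiom φ → ⊢ φ
  ⊢-mbC a = ⊢-axiom (inj₁ a)

  ⊢-mp : ∀ {α β} → ⊢ (α ⇒ β) → ⊢ α → ⊢ β
  ⊢-mp {α} {β} (φs , d) (ψs , e) =
    _ , mp (xs⊆ys++xs (α ∷ ψs) ((α ⇒ β) ∷ φs) (here refl)) (here refl)
        ∷ IsDerivation-++ d e

  ⊢-R∼ : ∀ {α β} → ⊢ (α ⇔ β) → ⊢ (∼ α ⇔ ∼ β)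
  ⊢-R∼ (_ , d) = _ , R∼ (here refl) ∷ d

  ⊢-R○ : ∀ {α β} → ⊢ (α ⇔ β) → ⊢ (○ α ⇔ ○ β)
  ⊢-R○ (_ , d) = _ , R○ (here refl) ∷ d

  -- Positive propositional reasoning

  ⇒-weaken : ∀ {α β} → ⊢ β → ⊢ (α ⇒ β)
  ⇒-weaken b = ⊢-mp (⊢-mbC (ax1 _ _)) b

  -- Modus ponens under a hypothesis `γ`; together with `⇒-weaken` it stands in for a deduction
  -- theorem.
  ⇒-app : ∀ {α β γ} → ⊢ (γ ⇒ (α ⇒ β)) → ⊢ (γ ⇒ α) → ⊢ (γ ⇒ β)
  ⇒-app f x = ⊢-mp (⊢-mp (⊢-mbC (ax2 _ _ _)) f) x

  ⇒-refl : ∀ {α} → ⊢ (α ⇒ α)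
  ⇒-refl {α} = ⇒-app (⊢-mbC (ax1 α (α ⇒ α))) (⊢-mbC (ax1 α α))

  ⇒-trans : ∀ {α β γ} → ⊢ (α ⇒ β) → ⊢ (β ⇒ γ) → ⊢ (α ⇒ γ)
  ⇒-trans f g = ⇒-app (⇒-weaken g) f

  ∧-fst : ∀ {α β} → ⊢ (α ∧ β ⇒ α)
  ∧-fst = ⊢-mbC (ax4 _ _)

  ∧-snd : ∀ {α β} → ⊢ (α ∧ β ⇒ β)
  ∧-snd = ⊢-mbC (ax5 _ _)

  ∧-pair : ∀ {α β γ} → ⊢ (γ ⇒ α) → ⊢ (γ ⇒ β) → ⊢ (γ ⇒ α ∧ β)
  ∧-pair f g = ⇒-app (⇒-trans f (⊢-mbC (ax3 _ _))) g

  ∨-case : ∀ {α β γ} → ⊢ (α ⇒ γ) → ⊢ (β ⇒ γ) → ⊢ (α ∨ β ⇒ γ)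
  ∨-case f g = ⊢-mp (⊢-mp (⊢-mbC (ax8 _ _ _)) f) g

  ⇒-curry : ∀ {α β γ} → ⊢ (α ∧ β ⇒ γ) → ⊢ (α ⇒ (β ⇒ γ))
  ⇒-curry f =
    ⇒-trans (⊢-mbC (ax3 _ _)) (⊢-mp (⊢-mbC (ax2 _ _ _)) (⇒-weaken f))

  ∧-mono : ∀ {α α′ β β′} → ⊢ (α ⇒ α′) → ⊢ (β ⇒ β′) → ⊢ (α ∧ β ⇒ α′ ∧ β′)
  ∧-mono f g = ∧-pair (⇒-trans ∧-fst f) (⇒-trans ∧-snd g)

  ∨-mono : ∀ {α α′ β β′} → ⊢ (α ⇒ α′) → ⊢ (β ⇒ β′) → ⊢ (α ∨ β ⇒ α′ ∨ β′)
  ∨-mono f g =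
    ∨-case (⇒-trans f (⊢-mbC (ax6 _ _))) (⇒-trans g (⊢-mbC (ax7 _ _)))

  ⇒-mono : ∀ {α α′ β β′} → ⊢ (α′ ⇒ α) → ⊢ (β ⇒ β′) → ⊢ ((α ⇒ β) ⇒ (α′ ⇒ β′))
  ⇒-mono f g = ⇒-curry (⇒-trans (⇒-app ∧-fst (⇒-trans ∧-snd f)) g)

  ⇔-intro : ∀ {α β} → ⊢ (α ⇒ β) → ⊢ (β ⇒ α) → ⊢ (α ⇔ β)
  ⇔-intro f g = ⊢-mp (⊢-mp (⊢-mbC (ax3 _ _)) f) g

  ⇔-to : ∀ {α β} → ⊢ (α ⇔ β) → ⊢ (α ⇒ β)
  ⇔-to = ⊢-mp ∧-fst

  ⇔-from : ∀ {α β} → ⊢ (α ⇔ β) → ⊢ (β ⇒ α)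
  ⇔-from = ⊢-mp ∧-snd

  -- Induction on `γ`: binary connectives are monotone, or antitone on the left of `⇒`, and the
  -- rules `R∼` and `R○` are exactly the two unary cases.
  replacement : ∀ {α β} → ⊢ (α ⇔ β) → ∀ γ p → ⊢ (γ [ p / α ] ⇔ γ [ p / β ])
  replacement e (var q) p with p ≡ᵇ q
  ... | true  = e
  ... | false = ⇔-intro ⇒-refl ⇒-refl
  replacement e (γ ∧ δ) p =
    ⇔-intro (∧-mono (⇔-to e₁) (⇔-to e₂)) (∧-mono (⇔-from e₁) (⇔-from e₂))
    where e₁ = replacement e γ p
          e₂ = replacement e δ p
  replacement e (γ ∨ δ) p =
    ⇔-intro (∨-mono (⇔-to e₁) (⇔-to e₂)) (∨-mono (⇔-from e₁) (⇔-from e₂))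
    where e₁ = replacement e γ p
          e₂ = replacement e δ p
  replacement e (γ ⇒ δ) p =
    ⇔-intro (⇒-mono (⇔-from e₁) (⇔-to e₂)) (⇒-mono (⇔-to e₁) (⇔-from e₂))
    where e₁ = replacement e γ p
          e₂ = replacement e δ p
  replacement e (∼ γ) p = ⊢-R∼ (replacement e γ p)
  replacement e (○ γ) p = ⊢-R○ (replacement e γ p)

  -- Consequence from premises

  ⋀-⁺++⁺ˡ : ∀ γ γs δs → ⊢ (⋀ ((γ ∷ γs) ⁺++⁺ δs) ⇒ ⋀ (γ ∷ γs))
  ⋀-⁺++⁺ˡ γ []        δs = ∧-fst
  ⋀-⁺++⁺ˡ γ (γ′ ∷ γs) δs = ∧-mono ⇒-refl (⋀-⁺++⁺ˡ γ′ γs δs)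

  ⋀-⁺++⁺ʳ : ∀ γ γs δs → ⊢ (⋀ ((γ ∷ γs) ⁺++⁺ δs) ⇒ ⋀ δs)
  ⋀-⁺++⁺ʳ γ []        δs = ∧-snd
  ⋀-⁺++⁺ʳ γ (γ′ ∷ γs) δs = ⇒-trans ∧-snd (⋀-⁺++⁺ʳ γ′ γs δs)

  module _ {Γ : Pred Formula 0ℓ} where

    ⊢-premise : ∀ {φ} → Γ φ → Γ ⊢RmbC+[ Extra ] φ
    ⊢-premise {φ} p = inj₂ (φ ∷ [] , p ∷ [] , ⇒-refl)

    -- When both arguments use premises, the two lists are concatenated, and the conjunction of the
    -- result implies each original conjunction.
    ⊢-mp-premises : ∀ {α β} →
      Γ ⊢RmbC+[ Extra ] (α ⇒ β) → Γ ⊢RmbC+[ Extra ] α → Γ ⊢RmbC+[ Extra ] β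
    ⊢-mp-premises (inj₁ f) (inj₁ x) = inj₁ (⊢-mp f x)
    ⊢-mp-premises (inj₁ f) (inj₂ (γs , ps , x)) = inj₂ (γs , ps , ⇒-trans x f)
    ⊢-mp-premises (inj₂ (γs , ps , f)) (inj₁ x) =
      inj₂ (γs , ps , ⇒-app f (⇒-weaken x))
    ⊢-mp-premises (inj₂ (γ ∷ γs , ps , f)) (inj₂ (δs , qs , x)) =
      inj₂ ((γ ∷ γs) ⁺++⁺ δs , ++⁺ ps qs ,
            ⇒-app (⇒-trans (⋀-⁺++⁺ˡ γ γs δs) f) (⇒-trans (⋀-⁺++⁺ʳ γ γs δs) x))

    ⊢Hilbert⇒⊢RmbC : ∀ {φs} → IsDerivation (HilbertStep (mbCAxiom ∪ Extra) Γ) φs →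
                     All (λ φ → Γ ⊢RmbC+[ Extra ] φ) φs
    ⊢Hilbert⇒⊢RmbC = IsDerivation-induction λ
      { (axiom a)   _  → inj₁ (⊢-axiom a)
      ; (premise p) _  → ⊢-premise p
      ; (mp x f)    ps → ⊢-mp-premises (All.lookup ps f) (All.lookup ps x)
      }

Ci⊆RCi : ∀ {Γ φ} → Γ ⊢Ci φ → Γ ⊢RCi φ
Ci⊆RCi (_ , d) = All.head (⊢Hilbert⇒⊢RmbC d)

-- The schema (cl)

∼○⇔contradiction : ∀ α → ⊢RCi (∼ ○ α ⇔ (α ∧ ∼ α))
∼○⇔contradiction α = ⇔-intro (⊢-axiom (inj₂ (ci α))) (⊢-mp cases (⊢-mbC (ax10 (○ α))))
  where
  -- Under `○ α` the contradiction explodes by `bc1`, whose arbitrary conclusion is taken to be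
  -- `∼ ○ α`.
  cases : ⊢RCi (○ α ∨ ∼ ○ α ⇒ (α ∧ ∼ α ⇒ ∼ ○ α))
  cases = ∨-case
    (⇒-curry (⇒-app (⇒-app (⇒-trans ∧-fst (⊢-mbC (bc1 _ _))) (⇒-trans ∧-snd ∧-fst))
                    (⇒-trans ∧-snd ∧-snd)))
    (⊢-mbC (ax1 _ _))

cl : ∀ α → ⊢RCi (∼ (α ∧ ∼ α) ⇒ ○ α)
cl α = ⇒-trans (⇔-from (⊢-R∼ (∼○⇔contradiction α))) (⊢-axiom (inj₂ (cf (○ α))))

-- The model

_⇒ᵇ_ : Bool → Bool → Bool
a ⇒ᵇ b = not a Bool.∨ b

⇒ᵇ-intro : ∀ {a b} → (a ≡ true → b ≡ true) → (a ⇒ᵇ b) ≡ true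
⇒ᵇ-intro {true}  f = f refl
⇒ᵇ-intro {false} f = refl

⇒ᵇ-elim : ∀ {a b} → (a ⇒ᵇ b) ≡ true → a ≡ true → b ≡ true
⇒ᵇ-elim f refl = f

⇒ᵇ-antisym : ∀ {a b} → (a ⇒ᵇ b) ≡ true → (b ⇒ᵇ a) ≡ true → a ≡ b
⇒ᵇ-antisym {true}          f g = sym f
⇒ᵇ-antisym {false} {true}  f g = g
⇒ᵇ-antisym {false} {false} f g = refl

∨-introˡ : ∀ {a} b → a ≡ true → a Bool.∨ b ≡ true
∨-introˡ b p = cong (Bool._∨ b) p

∨-introʳ : ∀ a {b} → b ≡ true → a Bool.∨ b ≡ true
∨-introʳ a q = trans (cong (a Bool.∨_) q) (∨-zeroʳ a)

∨-elim : ∀ {a b c} → (a ⇒ᵇ c) ≡ true → (b ⇒ᵇ c) ≡ true → ((a Bool.∨ b) ⇒ᵇ c) ≡ true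
∨-elim {true}  f g = f
∨-elim {false} f g = g

-- The first coordinate separates `proj₁` from its complement; the second marks, in each half, the
-- one world where `neg` may exceed complementation.
World : Set
World = Bool × Bool

Value : Set
Value = World → Bool

-- split a holds iff a is proj₁ or its complement.
split : Value → Bool
split a = (a (true , false) xor a (false , false))
  Bool.∧ not (a (true , true) xor a (true , false))
  Bool.∧ not (a (false , true) xor a (false , false))

neg : Value → Value
neg a w@(_ , j) = not (a w) Bool.∨ (j Bool.∧ split a)

circ : Value → Value
circ a w = not (a w Bool.∧ neg a w)

split-cong : ∀ {a b} → a ≗ b → split a ≡ split b
split-cong e = cong₂ Bool._∧_ (cong₂ _xor_ (e _) (e _))
  (cong₂ (λ x y → not x Bool.∧ not y) (cong₂ _xor_ (e _) (e _)) (cong₂ _xor_ (e _) (e _)))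

-- Since `split` reads all four worlds, `neg a w` depends on more than `a w`. Hence `R∼` preserves
-- validity but not truth at a single world.
neg-cong : ∀ {a b} → a ≗ b → neg a ≗ neg b
neg-cong e w@(_ , j) = cong₂ (λ x s → not x Bool.∨ (j Bool.∧ s)) (e w) (split-cong e)

circ-cong : ∀ {a b} → a ≗ b → circ a ≗ circ b
circ-cong e w = cong₂ (λ x y → not (x Bool.∧ y)) (e w) (neg-cong e w)

-- If `split a` holds, `neg a` has three elements; otherwise it is the complement of `a`, and
-- complementation preserves failure of `split`.
split-neg : ∀ a → split (neg a) ≡ false
split-neg a with a (true , true) | a (true , false) | a (false , true) | a (false , false)
... | true  | true  | true  | true  = refl
... | true  | true  | true  | false = refl
... | true  | true  | false | true  = refl
... | true  | true  | false | false = refl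
... | true  | false | true  | true  = refl
... | true  | false | true  | false = refl
... | true  | false | false | true  = refl
... | true  | false | false | false = refl
... | false | true  | true  | true  = refl
... | false | true  | true  | false = refl
... | false | true  | false | true  = refl
... | false | true  | false | false = refl
... | false | false | true  | true  = refl
... | false | false | true  | false = refl
... | false | false | false | true  = refl
... | false | false | false | false = refl

-- At worlds (i , false), neg is complementation, so circ a is true at both.
split-circ : ∀ a → split (circ a) ≡ false
split-circ a with a (true , false) | a (false , false)
... | true  | true  = refl
... | true  | false = refl
... | false | true  = refl
... | false | false = refl

neg-classical : ∀ {a} → split a ≡ false → ∀ w → neg a w ≡ not (a w)
neg-classical {a} s w@(_ , j) =
  trans (cong (λ s → not (a w) Bool.∨ (j Bool.∧ s)) s)
        (trans (cong (not (a w) Bool.∨_) (∧-zeroʳ j)) (∨-identityʳ _))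

neg-excludedMiddle : ∀ a w → a w Bool.∨ neg a w ≡ true
neg-excludedMiddle a w with a w
... | true  = refl
... | false = refl

-- The outer `neg` is complementation by `split-neg`, and `neg a` contains the complement of `a`.
neg-neg : ∀ a w → neg (neg a) w ≡ true → a w ≡ true
neg-neg a w p = double-negation (trans (sym (neg-classical {neg a} (split-neg a) w)) p)
  where
  double-negation : ∀ {x y} → not (not x Bool.∨ y) ≡ true → x ≡ true
  double-negation {true} _ = refl

neg-circ : ∀ a w → neg (circ a) w ≡ a w Bool.∧ neg a w
neg-circ a w = trans (neg-classical {circ a} (split-circ a) w) (not-involutive _)

circ-explosive : ∀ a w → circ a w ≡ true → a w ≡ true → ¬ (neg a w ≡ true)
circ-explosive a w c p n
  with () ← trans (sym c) (cong₂ (λ x y → not (x Bool.∧ y)) p n)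

-- Soundness

module _ (v : ℕ → Value) where

  ⟦_⟧ : Formula → Value
  ⟦ var n ⟧   = v n
  ⟦ α ∧ β ⟧ w = ⟦ α ⟧ w Bool.∧ ⟦ β ⟧ w
  ⟦ α ∨ β ⟧ w = ⟦ α ⟧ w Bool.∨ ⟦ β ⟧ w
  ⟦ α ⇒ β ⟧ w = ⟦ α ⟧ w ⇒ᵇ ⟦ β ⟧ w
  ⟦ ∼ α ⟧     = neg ⟦ α ⟧
  ⟦ ○ α ⟧     = circ ⟦ α ⟧

  Valid : Pred Formula 0ℓ
  Valid φ = ∀ w → ⟦ φ ⟧ w ≡ true

  mbC-valid : ∀ {φ} → mbCAxiom φ → Valid φ
  mbC-valid (ax1 α β) w = ⇒ᵇ-intro {⟦ α ⟧ w} λ x → ⇒ᵇ-intro {⟦ β ⟧ w} λ _ → x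
  mbC-valid (ax2 α β γ) w =
    ⇒ᵇ-intro {⟦ α ⇒ (β ⇒ γ) ⟧ w} λ f → ⇒ᵇ-intro {⟦ α ⇒ β ⟧ w} λ g → ⇒ᵇ-intro λ x →
    ⇒ᵇ-elim {⟦ β ⟧ w} (⇒ᵇ-elim f x) (⇒ᵇ-elim g x)
  mbC-valid (ax3 α β) w =
    ⇒ᵇ-intro {⟦ α ⟧ w} λ x → ⇒ᵇ-intro {⟦ β ⟧ w} λ y → cong₂ Bool._∧_ x y
  mbC-valid (ax4 α β) w = ⇒ᵇ-intro {⟦ α ∧ β ⟧ w} (∧-conicalˡ _ _)
  mbC-valid (ax5 α β) w = ⇒ᵇ-intro {⟦ α ∧ β ⟧ w} (∧-conicalʳ (⟦ α ⟧ w) _)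
  mbC-valid (ax6 α β) w = ⇒ᵇ-intro {⟦ α ⟧ w} (∨-introˡ _)
  mbC-valid (ax7 α β) w = ⇒ᵇ-intro {⟦ β ⟧ w} (∨-introʳ (⟦ α ⟧ w))
  mbC-valid (ax8 α β γ) w =
    ⇒ᵇ-intro {⟦ α ⇒ γ ⟧ w} λ f → ⇒ᵇ-intro {⟦ β ⇒ γ ⟧ w} λ g → ∨-elim {⟦ α ⟧ w} f g
  mbC-valid (ax9 α β) w with ⟦ α ⟧ w
  ... | true  = ∨-zeroʳ _
  ... | false = refl
  mbC-valid (ax10 α) w = neg-excludedMiddle ⟦ α ⟧ w
  mbC-valid (bc1 α β) w =
    ⇒ᵇ-intro {⟦ ○ α ⟧ w} λ c → ⇒ᵇ-intro {⟦ α ⟧ w} λ p → ⇒ᵇ-intro {⟦ ∼ α ⟧ w} λ n →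
    contradiction n (circ-explosive ⟦ α ⟧ w c p)

  CfCi-valid : ∀ {φ} → CfCiAxiom φ → Valid φ
  CfCi-valid (cf α) w = ⇒ᵇ-intro {⟦ ∼ ∼ α ⟧ w} (neg-neg ⟦ α ⟧ w)
  CfCi-valid (ci α) w = ⇒ᵇ-intro {⟦ ∼ ○ α ⟧ w} (trans (sym (neg-circ ⟦ α ⟧ w)))

  Valid-⇔ : ∀ {α β} → ⟦ α ⟧ ≗ ⟦ β ⟧ → Valid (α ⇔ β)
  Valid-⇔ {α} {β} e w = cong₂ Bool._∧_
    (⇒ᵇ-intro {⟦ α ⟧ w} (trans (sym (e w)))) (⇒ᵇ-intro {⟦ β ⟧ w} (trans (e w)))

  -- This turns the premise of `R∼` or `R○` into the pointwise equality that the congruence lemmas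
  -- expect.
  Valid-⇔⁻ : ∀ {α β} → Valid (α ⇔ β) → ⟦ α ⟧ ≗ ⟦ β ⟧
  Valid-⇔⁻ {α} {β} e w =
    ⇒ᵇ-antisym {⟦ α ⟧ w} (∧-conicalˡ _ _ (e w)) (∧-conicalʳ (⟦ α ⇒ β ⟧ w) _ (e w))

  RCi-step-valid : ∀ {φ φs} → RStep (mbCAxiom ∪ CfCiAxiom) φs φ → All Valid φs → Valid φ
  RCi-step-valid (axiom (inj₁ a)) _ = mbC-valid a
  RCi-step-valid (axiom (inj₂ a)) _ = CfCi-valid a
  RCi-step-valid (mp {α} x f) vs w = ⇒ᵇ-elim (All.lookup vs f w) (All.lookup vs x w)
  RCi-step-valid (R∼ {α} {β} e) vs =
    Valid-⇔ {∼ α} {∼ β} (neg-cong (Valid-⇔⁻ {α} {β} (All.lookup vs e)))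
  RCi-step-valid (R○ {α} {β} e) vs =
    Valid-⇔ {○ α} {○ β} (circ-cong (Valid-⇔⁻ {α} {β} (All.lookup vs e)))

  RCi-sound : ∀ {φ} → ⊢RCi φ → Valid φ
  RCi-sound (_ , d) = All.head (IsDerivation-induction RCi-step-valid d)

  ⋀-true : ∀ {w} γs → All (λ γ → ⟦ γ ⟧ w ≡ true) (toList γs) → ⟦ ⋀ γs ⟧ w ≡ true
  ⋀-true (γ ∷ [])      (p ∷ [])     = p
  ⋀-true (γ ∷ γ′ ∷ γs) (p ∷ p′ ∷ ps) = cong₂ Bool._∧_ p (⋀-true (γ′ ∷ γs) (p′ ∷ ps))

  -- The theorem `⋀ γs ⇒ φ` is valid, so it can be read at the one world where the premises are
  -- true.
  RCi-sound-local : ∀ {Γ φ} → Γ ⊢RCi φ →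
    ∀ w → (∀ {γ} → Γ γ → ⟦ γ ⟧ w ≡ true) → ⟦ φ ⟧ w ≡ true
  RCi-sound-local (inj₁ d) w _ = RCi-sound d w
  RCi-sound-local (inj₂ (γs , ps , d)) w Γ-true =
    ⇒ᵇ-elim (RCi-sound d w) (⋀-true γs (All.map Γ-true ps))

-- Paraconsistency

paraconsistent : ¬ ((｛ var 0 ｝ ∪ ｛ ∼ var 0 ｝) ⊢RCi var 1)
-- `(true , true)` is the only world in both `proj₁` and `neg proj₁`; `var 1` is false there.
paraconsistent d = contradiction (RCi-sound-local v d (true , true) premises) λ ()
  where
  v : ℕ → Value
  v zero    = proj₁
  v (suc _) = λ _ → false

  premises : ∀ {γ} → (｛ var 0 ｝ ∪ ｛ ∼ var 0 ｝) γ → ⟦ v ⟧ γ (true , true) ≡ true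
  premises (inj₁ refl) = refl
  premises (inj₂ refl) = refl

mainTheorem2 : (∀ (Γ : Pred Formula 0ℓ) (φ : Formula) → Γ ⊢Ci φ → Γ ⊢RCi φ)
    × (∀ (α β : Formula) → ⊢RCi (α ⇔ β) →
    ∀ (γ : Formula) (p : ℕ) → ⊢RCi (γ [ p / α ] ⇔ γ [ p / β ]))
    × (∀ (α : Formula) → ⊢RCi (∼ (α ∧ ∼ α) ⇒ ○ α))
    × (∃[ φ ] ∃[ ψ ] ¬ ((｛ φ ｝ ∪ ｛ ∼ φ ｝) ⊢RCi ψ))
mainTheorem2 =
    (λ _ _ → Ci⊆RCi)
  , (λ _ _ → replacement)
  , cl
  , var 0 , var 1 , paraconsistent
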